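{- Let $\alpha,\beta\ge 1$. For the problem of scheduling with uncertain processing times on a single machine with the objective of minimizing the total completion time, the competitive ratio of the algorithm $(\alpha,\beta)$-SORT is at most $$\max\left\{\alpha\left(1+\tfrac1\beta\right),\ 1+\tfrac1\alpha+\tfrac1\beta,\ 1+\beta,\ 2,\ 1+\tfrac2\alpha\right\}.$$
   Context: Problem. There are $n$ jobs, all available at time $0$. Job $j$ has a testing time $t_j\ge 0$, an upper limit $u_j\ge 0$, and a real processing time $p_j\in[0,u_j]$. A job may be executed untested, which takes $u_j$ time units, or it may be tested (taking $t_j$ time units) and later executed in $p_j$ time units; other tasks may run between the test and the execution. The tasks regarding $j$ are its testing, its execution (after testing), or its execution-untested. A single machine runs one task at a time. The completion time of a job is the time at which its execution (or execution-untested) ends, and the cost of a schedule is the sum of the completion times of all jobs. An online algorithm knows all $t_j,u_j$ from the start, but learns $p_j$ only when the test of $j$ is finished. $\mathrm{OPT}$ knows all $p_j$ in advance (but must still test $j$ in order to run it in time $p_j$), and its cost is the minimum cost of any schedule; it spends $p_j^*=\min\{u_j,t_j+p_j\}$ on job $j$ and runs jobs in non-decreasing order of $p_j^*$. The competitive ratio of an online algorithm $A$ is the smallest $c$ such that $\mathrm{cost}(A)\le c\cdot \mathrm{cost}(\mathrm{OPT})$ on all instances. Algorithm $(\alpha,\beta)$-SORT. Maintain a priority queue of tasks, smaller weight meaning higher priority (ties broken arbitrarily). Initially, for each job $j$: if $u_j\ge\alpha t_j$, insert a testing task of weight $\beta t_j$; otherwise insert an execution-untested task of weight $u_j$. While the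 queue is nonempty, extract a task of smallest weight and run it; if it was the testing task of job $j$, then after the test insert an execution task for $j$ with weight $p_j$. -}

module Defs where

open import Level using (Level; _⊔_) renaming (suc to lsuc)
open import Algebra.Bundles using (CommutativeRing)
open import Algebra.Structures using (IsCommutativeRing)
import Algebra.Construct.NaturalChoice.Max as NaturalMax
import Algebra.Properties.Monoid.Sum as MonoidSum
open import Data.Bool.Base using (Bool; false; if_then_else_)
open import Data.Fin.Base using (Fin)
open import Data.Fin.Properties using (_≟_)
open import Data.List.Base using (List; []; _∷_; _++_; map; filter; allFin)
open import Data.List.Relation.Binary.Permutation.Propositional using (_↭_)
open import Data.List.Relation.Unary.All using (All)
open import Data.Nat.Base using (ℕ)
open import Data.Product.Base using (_×_)
open import Data.Sum.Base using (_⊎_)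
open import Relation.Binary.Bundles using (DecTotalOrder)
open import Relation.Binary.PropositionalEquality.Core using (_≡_; _≢_)
open import Relation.Binary.Structures using (IsDecTotalOrder)
open import Relation.Nullary.Decidable.Core using (does)

-- The intended model is ℝ with its classical (hence decidable) order; no
-- completeness is assumed, so ℚ is a model too.  The inverse is total, and its
-- value at 0# is unspecified.
record OrderedField (c ℓ : Level) : Set (lsuc (c ⊔ ℓ)) where
  infix  8 _⁻¹ -_
  infixl 7 _*_ _/_
  infixl 6 _+_
  infix  4 _≤_
  field
    Carrier           : Set c
    _≤_               : Carrier → Carrier → Set ℓ
    _+_ _*_           : Carrier → Carrier → Carrier
    -_ _⁻¹            : Carrier → Carrier
    0# 1#             : Carrier
    isCommutativeRing : IsCommutativeRing _≡_ _+_ _*_ -_ 0# 1#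
    0≢1               : 0# ≢ 1#
    ⁻¹-inverseʳ       : ∀ x → x ≢ 0# → x * x ⁻¹ ≡ 1#
    isDecTotalOrder   : IsDecTotalOrder _≡_ _≤_
    +-monoʳ-≤         : ∀ z {x y} → x ≤ y → z + x ≤ z + y
    *-nonNegative     : ∀ {x y} → 0# ≤ x → 0# ≤ y → 0# ≤ x * y

  _/_ : Carrier → Carrier → Carrier
  x / y = x * y ⁻¹

  2# : Carrier
  2# = 1# + 1#

  commutativeRing : CommutativeRing c c
  commutativeRing = record { isCommutativeRing = isCommutativeRing }

  decTotalOrder : DecTotalOrder c c ℓ
  decTotalOrder = record { isDecTotalOrder = isDecTotalOrder }

  open DecTotalOrder decTotalOrder public using (_≤?_; totalOrder)

  open NaturalMax totalOrder public using () renaming (_⊔_ to max)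

  open MonoidSum (CommutativeRing.+-monoid commutativeRing) public using (sum)

module Scheduling {c ℓ : Level} (F : OrderedField c ℓ) where

  open OrderedField F

  record Instance : Set (c ⊔ ℓ) where
    field
      n     : ℕ
      t u p : Fin n → Carrier
      0≤t   : ∀ j → 0# ≤ t j
      0≤u   : ∀ j → 0# ≤ u j
      0≤p   : ∀ j → 0# ≤ p j
      p≤u   : ∀ j → p j ≤ u j

  data Task (n : ℕ) : Set where
    test executeTested executeUntested : Fin n → Task n

  job : ∀ {n} → Task n → Fin n
  job (test j)            = j
  job (executeTested j)   = j
  job (executeUntested j) = j

  completes : ∀ {n} → Task n → Fin n → Bool
  completes (test _)            _ = false
  completes (executeTested i)   j = does (i ≟ j)
  completes (executeUntested i) j = does (i ≟ j)

  data Action (n : ℕ) : Set (c ⊔ ℓ) where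
    idle : (d : Carrier) → 0# ≤ d → Action n
    run  : Task n → Action n

  -- Actions are carried out back to back from time 0, without preemption.
  Schedule : ℕ → Set (c ⊔ ℓ)
  Schedule n = List (Action n)

  tasks : ∀ {n} → Schedule n → List (Task n)
  tasks []             = []
  tasks (idle _ _ ∷ σ) = tasks σ
  tasks (run x ∷ σ)    = x ∷ tasks σ

  tasksRegarding : ∀ {n} → Fin n → Schedule n → List (Task n)
  tasksRegarding j σ = filter (λ x → job x ≟ j) (tasks σ)

  Feasible : ∀ {n} → Schedule n → Set
  Feasible σ = ∀ j →
    tasksRegarding j σ ≡ executeUntested j ∷ [] ⊎
    tasksRegarding j σ ≡ test j ∷ executeTested j ∷ []

  module _ (I : Instance) where
    open Instance I

    duration : Task n → Carrier
    duration (test j)            = t j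
    duration (executeTested j)   = p j
    duration (executeUntested j) = u j

    -- The value for a schedule that never executes j is irrelevant: feasible
    -- schedules execute every job.
    completionTime : Schedule n → Fin n → Carrier
    completionTime []             j = 0#
    completionTime (idle d _ ∷ σ) j = d + completionTime σ j
    completionTime (run x ∷ σ)    j =
      if completes x j then duration x else duration x + completionTime σ j

    cost : Schedule n → Carrier
    cost σ = sum (completionTime σ)

    IsOPT : Schedule n → Set (c ⊔ ℓ)
    IsOPT σ = Feasible σ × (∀ σ′ → Feasible σ′ → cost σ ≤ cost σ′)

  -- A relation rather than a function, since ties may be broken
  -- arbitrarily: A I σ says that σ is a possible output of A on I.
  Algorithm : Set (lsuc (c ⊔ ℓ))
  Algorithm = (I : Instance) → Schedule (Instance.n I) → Set (c ⊔ ℓ)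

  Competitive : Algorithm → Carrier → Set (c ⊔ ℓ)
  Competitive A r = ∀ I σ → A I σ → ∀ σ* → IsOPT I σ* → cost I σ ≤ r * cost I σ*

  IsCompetitiveRatio : Algorithm → Carrier → Set (c ⊔ ℓ)
  IsCompetitiveRatio A r = Competitive A r × (∀ r′ → Competitive A r′ → r ≤ r′)

  -- Without completeness of the field a least such r need not exist, so the
  -- second component alone could hold vacuously.
  CompetitiveRatioAtMost : Algorithm → Carrier → Set (c ⊔ ℓ)
  CompetitiveRatioAtMost A b =
    Competitive A b × (∀ r → IsCompetitiveRatio A r → r ≤ b)

  module _ (α β : Carrier) (I : Instance) where
    open Instance I

    weight : Task n → Carrier
    weight (test j)            = β * t j
    weight (executeTested j)   = p j
    weight (executeUntested j) = u j

    initialTask : Fin n → Task n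
    initialTask j = if does (α * t j ≤? u j) then test j else executeUntested j

    insertedAfter : Task n → List (Task n)
    insertedAfter (test j)            = executeTested j ∷ []
    insertedAfter (executeTested _)   = []
    insertedAfter (executeUntested _) = []

    -- Run Q σ: started with the queue contents Q, the main loop may produce σ.
    data Run : List (Task n) → Schedule n → Set (c ⊔ ℓ) where
      stop    : Run [] []
      extract : ∀ {Q Q′ x σ} →
                Q ↭ x ∷ Q′ →
                All (λ y → weight x ≤ weight y) Q′ →
                Run (insertedAfter x ++ Q′) σ →
                Run Q (run x ∷ σ)

  SORT : Carrier → Carrier → Algorithm
  SORT α β I σ = Run α β I (map (initialTask α β I) (allFin (Instance.n I))) σ

{-# OPTIONS --safe #-}

-- Charge every unit of machine time to a pair of jobs: delay l i j is the time
-- spent on job i before job j completes, so the cost of a schedule without idle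
-- time is the sum of all delays.  In any feasible schedule, of two jobs i and j
-- the one completing first delays the other by its whole work, which is u or
-- t + p.  It therefore suffices that SORT's mutual delay of i and j is at most
-- r times u and r times t + p of either job; since SORT restricted to a set of
-- jobs is again a run of SORT, this only involves two-job queues.

module Submission where

open import Level using (Level; _⊔_)
open import Defs

open import Algebra.Bundles using (CommutativeRing)
import Algebra.Properties.Ring as RingProperties
import Algebra.Properties.Semiring.Sum as SemiringSum
import Algebra.Solver.Ring.NaturalCoefficients.Default as NaturalSolver
import Algebra.Construct.NaturalChoice.Max as NaturalMax
open import Data.Bool.Base using (true; false; if_then_else_)
open import Data.Fin.Base using (Fin; zero; suc)
open import Data.Fin.Properties using (_≟_)
open import Data.List.Base using (List; []; _∷_; [_]; _++_; map; filter; allFin)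
open import Data.List.Membership.DecPropositional using (_∈?_)
open import Data.List.Membership.Propositional using (_∈_)
open import Data.List.Membership.Propositional.Properties using (∈-allFin; ∈-filter⁺; ∈-filter⁻)
open import Data.List.Membership.Propositional.Properties.WithK using (unique∧set⇒bag)
open import Data.List.Properties using (filter-++; filter-accept; filter-reject)
open import Data.List.Relation.Binary.BagAndSetEquality using (∼bag⇒↭)
open import Data.List.Relation.Binary.Permutation.Propositional
  using (_↭_; swap; trans; ↭-sym; ↭-trans; ↭-reflexive)
open import Data.List.Relation.Binary.Permutation.Propositional.Properties
  using (↭-empty-inv; ↭-singleton-inv; ∈-resp-↭; All-resp-↭; drop-∷; filter-↭; map⁺)
open import Data.List.Relation.Unary.All using (All; []; _∷_)
import Data.List.Relation.Unary.All.Properties as All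
open import Data.List.Relation.Unary.AllPairs using ([]; _∷_)
open import Data.List.Relation.Unary.Any using (here; there)
open import Data.List.Relation.Unary.Unique.Propositional using (Unique)
import Data.List.Relation.Unary.Unique.Propositional.Properties as Unique
open import Data.Nat.Base using (ℕ)
open import Data.Product.Base using (∃-syntax; _×_; _,_; proj₁; proj₂)
open import Data.Sum.Base using (_⊎_; inj₁; inj₂; reduce)
open import Data.Unit.Polymorphic.Base using (⊤; tt)
open import Function.Base using (_∘_)
open import Function.Bundles using (mk⇔)
open import Relation.Binary.Bundles using (DecTotalOrder)
import Relation.Binary.Reasoning.PartialOrder as PartialOrderReasoning
open import Relation.Binary.PropositionalEquality.Core
  using (_≡_; _≢_; refl; sym; cong; cong₂; subst; ≢-sym) renaming (trans to ≡-trans)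
open import Relation.Nullary.Decidable using (does; yes; no; dec-true; dec-false)
open import Relation.Nullary.Negation using (¬_; contradiction)
open import Relation.Unary using (Pred; Decidable)

-- Sublists of the list of all jobs.

filter-allFin-↭ : ∀ {n} {xs : List (Fin n)} → Unique xs → filter (λ k → _∈?_ _≟_ k xs) (allFin n) ↭ xs
filter-allFin-↭ {n} {xs} unique =
  -- Neither list has duplicates, so having the same members already makes them equal as bags.
  ∼bag⇒↭ (unique∧set⇒bag (Unique.filter⁺ ∈xs? (Unique.allFin⁺ n)) unique
    (mk⇔ (proj₂ ∘ ∈-filter⁻ ∈xs? {xs = allFin n}) (∈-filter⁺ ∈xs? (∈-allFin _))))
  where
  ∈xs? : Decidable (_∈ xs)
  ∈xs? k = _∈?_ _≟_ k xs

-- Used with `initialTask` as `f` and `job` as `g`: discarding the tasks of some jobs from the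
-- initial queue leaves the initial queue of the remaining jobs.
filter-map-section : ∀ {a b p} {A : Set a} {B : Set b} {P : Pred A p} (P? : Decidable P)
                     {f : A → B} {g : B → A} → (∀ x → g (f x) ≡ x) →
                     ∀ xs → filter (P? ∘ g) (map f xs) ≡ map f (filter P? xs)
filter-map-section P? gf []       = refl
filter-map-section P? {f} gf (x ∷ xs) with does (P? x) | cong (does ∘ P?) (gf x)
... | true  | eq rewrite eq = cong (f x ∷_) (filter-map-section P? gf xs)
... | false | eq rewrite eq = filter-map-section P? gf xs

-- Arithmetic in an ordered field.

module OrderedFieldProperties {c ℓ : Level} (F : OrderedField c ℓ) where

  open OrderedField F
  open CommutativeRing commutativeRing public
    using ( +-comm; +-assoc; +-identityˡ; +-identityʳ; -‿inverseˡ; -‿inverseʳ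
          ; *-comm; *-assoc; *-identityˡ; *-identityʳ; distribˡ
          ; ring; semiring; commutativeSemiring)
  open DecTotalOrder decTotalOrder public using (poset; total; antisym)
    renaming (refl to ≤-refl; reflexive to ≤-reflexive; trans to ≤-trans)
  open RingProperties ring using (-‿distribˡ-*; -‿distribʳ-*; -‿involutive)
  open SemiringSum semiring public
    using (sum-cong-≗; sum-replicate-zero; ∑-distrib-+; ∑-comm; *-distribˡ-sum)
  open NaturalSolver commutativeSemiring public using (solve; con; _:=_; _:+_; _:*_)
  open NaturalMax totalOrder public using (x≤x⊔y; x≤y⊔x)
  open PartialOrderReasoning poset

  +-monoˡ-≤ : ∀ z {x y} → x ≤ y → x + z ≤ y + z
  +-monoˡ-≤ z {x} {y} x≤y = begin
    x + z ≡⟨ +-comm x z ⟩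
    z + x ≤⟨ +-monoʳ-≤ z x≤y ⟩
    z + y ≡⟨ +-comm z y ⟩
    y + z ∎

  +-mono-≤ : ∀ {w x y z} → w ≤ x → y ≤ z → w + y ≤ x + z
  +-mono-≤ {x = x} {y} w≤x y≤z = ≤-trans (+-monoˡ-≤ y w≤x) (+-monoʳ-≤ x y≤z)

  +-nonNegative : ∀ {x y} → 0# ≤ x → 0# ≤ y → 0# ≤ x + y
  +-nonNegative 0≤x 0≤y = ≤-trans (≤-reflexive (sym (+-identityˡ 0#))) (+-mono-≤ 0≤x 0≤y)

  x≤x+y : ∀ {x y} → 0# ≤ y → x ≤ x + y
  x≤x+y {x} 0≤y = ≤-trans (≤-reflexive (sym (+-identityʳ x))) (+-monoʳ-≤ x 0≤y)

  x≤y+x : ∀ {x y} → 0# ≤ y → x ≤ y + x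
  x≤y+x {x} 0≤y = ≤-trans (≤-reflexive (sym (+-identityˡ x))) (+-monoˡ-≤ x 0≤y)

  +-cancelˡ-≤ : ∀ z {x y} → z + x ≤ z + y → x ≤ y
  +-cancelˡ-≤ z {x} {y} z+x≤z+y = begin
    x               ≡⟨ -z+[z+w]≡w x ⟨
    - z + (z + x)   ≤⟨ +-monoʳ-≤ (- z) z+x≤z+y ⟩
    - z + (z + y)   ≡⟨ -z+[z+w]≡w y ⟩
    y               ∎
    where
    -z+[z+w]≡w : ∀ w → - z + (z + w) ≡ w
    -z+[z+w]≡w w = ≡-trans (sym (+-assoc (- z) z w))
                     (≡-trans (cong (_+ w) (-‿inverseˡ z)) (+-identityˡ w))

  -- Takes the place of halving. If `y ≤ x`, then `y + x ≤ x + x ≤ y + y`, and `y` cancels.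
  x+x≤y+y⇒x≤y : ∀ {x y} → x + x ≤ y + y → x ≤ y
  x+x≤y+y⇒x≤y {x} {y} x+x≤y+y with total x y
  ... | inj₁ x≤y = x≤y
  ... | inj₂ y≤x = +-cancelˡ-≤ y (≤-trans (+-monoˡ-≤ x y≤x) x+x≤y+y)

  *-monoʳ-≤ : ∀ {z x y} → 0# ≤ z → x ≤ y → z * x ≤ z * y
  *-monoʳ-≤ {z} {x} {y} 0≤z x≤y = begin
    z * x                   ≤⟨ x≤x+y (*-nonNegative 0≤z 0≤-x+y) ⟩
    z * x + z * (- x + y)   ≡⟨ distribˡ z x (- x + y) ⟨
    z * (x + (- x + y))     ≡⟨ cong (z *_) (+-assoc x (- x) y) ⟨
    z * (x + - x + y)       ≡⟨ cong (λ w → z * (w + y)) (-‿inverseʳ x) ⟩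
    z * (0# + y)            ≡⟨ cong (z *_) (+-identityˡ y) ⟩
    z * y                   ∎
    where
    0≤-x+y : 0# ≤ - x + y
    0≤-x+y = ≤-trans (≤-reflexive (sym (-‿inverseˡ x))) (+-monoʳ-≤ (- x) x≤y)

  *-monoˡ-≤ : ∀ {z x y} → 0# ≤ z → x ≤ y → x * z ≤ y * z
  *-monoˡ-≤ {z} {x} {y} 0≤z x≤y = begin
    x * z ≡⟨ *-comm x z ⟩
    z * x ≤⟨ *-monoʳ-≤ 0≤z x≤y ⟩
    z * y ≡⟨ *-comm z y ⟩
    y * z ∎

  -- Squares supply the two signs that the axioms do not state: that of `1#`, and that of an
  -- inverse.
  x*x-nonNegative : ∀ x → 0# ≤ x * x
  x*x-nonNegative x with total 0# x
  ... | inj₁ 0≤x = *-nonNegative 0≤x 0≤x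
  ... | inj₂ x≤0 = begin
    0#            ≤⟨ *-nonNegative 0≤-x 0≤-x ⟩
    - x * - x     ≡⟨ -‿distribˡ-* x (- x) ⟨
    - (x * - x)   ≡⟨ cong -_ (-‿distribʳ-* x x) ⟨
    - - (x * x)   ≡⟨ -‿involutive (x * x) ⟩
    x * x         ∎
    where
    0≤-x : 0# ≤ - x
    0≤-x = begin
      0#         ≡⟨ -‿inverseˡ x ⟨
      - x + x    ≤⟨ +-monoʳ-≤ (- x) x≤0 ⟩
      - x + 0#   ≡⟨ +-identityʳ (- x) ⟩
      - x        ∎

  0≤1 : 0# ≤ 1#
  0≤1 = ≤-trans (x*x-nonNegative 1#) (≤-reflexive (*-identityˡ 1#))

  module _ {x : Carrier} (1≤x : 1# ≤ x) where

    0≤x : 0# ≤ x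
    0≤x = ≤-trans 0≤1 1≤x

    x*x⁻¹≡1 : x * x ⁻¹ ≡ 1#
    x*x⁻¹≡1 = ⁻¹-inverseʳ x λ x≡0 → 0≢1 (antisym 0≤1 (subst (1# ≤_) x≡0 1≤x))

    -- The inverse equals `x` times its own square, a product of nonnegative factors.
    0≤x⁻¹ : 0# ≤ x ⁻¹
    0≤x⁻¹ = begin
      0#                  ≤⟨ *-nonNegative 0≤x (x*x-nonNegative (x ⁻¹)) ⟩
      x * (x ⁻¹ * x ⁻¹)   ≡⟨ *-assoc x (x ⁻¹) (x ⁻¹) ⟨
      x * x ⁻¹ * x ⁻¹     ≡⟨ cong (_* x ⁻¹) x*x⁻¹≡1 ⟩
      1# * x ⁻¹           ≡⟨ *-identityˡ (x ⁻¹) ⟩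
      x ⁻¹                ∎

    x⁻¹*[x*y]≡y : ∀ y → x ⁻¹ * (x * y) ≡ y
    x⁻¹*[x*y]≡y y = ≡-trans (sym (*-assoc (x ⁻¹) x y))
                      (≡-trans (cong (_* y) (≡-trans (*-comm (x ⁻¹) x) x*x⁻¹≡1)) (*-identityˡ y))

    x*y≤z⇒y≤x⁻¹*z : ∀ {y z} → x * y ≤ z → y ≤ x ⁻¹ * z
    x*y≤z⇒y≤x⁻¹*z {y} xy≤z =
      ≤-trans (≤-reflexive (sym (x⁻¹*[x*y]≡y y))) (*-monoʳ-≤ 0≤x⁻¹ xy≤z)

    x*-cancel-≤ : ∀ {y z} → x * y ≤ x * z → y ≤ z
    x*-cancel-≤ {y} {z} xy≤xz = ≤-trans (x*y≤z⇒y≤x⁻¹*z xy≤xz) (≤-reflexive (x⁻¹*[x*y]≡y z))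

    y≤x*y : ∀ {y} → 0# ≤ y → y ≤ x * y
    y≤x*y {y} 0≤y = ≤-trans (≤-reflexive (sym (*-identityˡ y))) (*-monoˡ-≤ 0≤y 1≤x)

  -- Finite sums and double sums over pairs of jobs.

  sum-mono-≤ : ∀ {n} {f g : Fin n → Carrier} → (∀ i → f i ≤ g i) → sum f ≤ sum g
  sum-mono-≤ {ℕ.zero}  f≤g = ≤-refl
  sum-mono-≤ {ℕ.suc n} f≤g = +-mono-≤ (f≤g zero) (sum-mono-≤ (f≤g ∘ suc))

  sum-if-≟ : ∀ {n} (k : Fin n) x → sum (λ i → if does (k ≟ i) then x else 0#) ≡ x
  sum-if-≟ {ℕ.suc n} zero    x = ≡-trans (cong (x +_) (sum-replicate-zero n)) (+-identityʳ x)
  sum-if-≟ {ℕ.suc n} (suc k) x = ≡-trans (+-identityˡ _) (sum-if-≟ k x)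

  sum-symmetrise : ∀ {n} (f : Fin n → Fin n → Carrier) →
    sum (λ j → sum (λ i → f i j)) + sum (λ j → sum (λ i → f i j)) ≡
    sum (λ j → sum (λ i → f i j + f j i))
  sum-symmetrise f =
    ≡-trans (cong (sum (λ j → sum (λ i → f i j)) +_) (∑-comm (λ j i → f i j)))
      (≡-trans (sym (∑-distrib-+ (λ j → sum (λ i → f i j)) (λ j → sum (λ i → f j i))))
        (sum-cong-≗ (λ j → sym (∑-distrib-+ (λ i → f i j) (λ i → f j i)))))

  -- Doubling both sums and exchanging the order of summation puts `f i j` next to `f j i`. Hence
  -- only the symmetrised entries have to be compared; a single entry of `f` may well exceed `r`
  -- times that of `g`.
  sum-pairwise-≤ : ∀ {n} r (f g : Fin n → Fin n → Carrier) →
    (∀ i j → f i j + f j i ≤ r * (g i j + g j i)) →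
    sum (λ j → sum (λ i → f i j)) ≤ r * sum (λ j → sum (λ i → g i j))
  sum-pairwise-≤ r f g f≤rg = x+x≤y+y⇒x≤y (begin
    Σf + Σf                                        ≡⟨ sum-symmetrise f ⟩
    sum (λ j → sum (λ i → f i j + f j i))          ≤⟨ sum-mono-≤ (λ j → sum-mono-≤ (λ i → f≤rg i j)) ⟩
    sum (λ j → sum (λ i → r * (g i j + g j i)))    ≡⟨ sum-cong-≗ (λ j → *-distribˡ-sum r (λ i → g i j + g j i)) ⟨
    sum (λ j → r * sum (λ i → g i j + g j i))      ≡⟨ *-distribˡ-sum r (λ j → sum (λ i → g i j + g j i)) ⟨
    r * sum (λ j → sum (λ i → g i j + g j i))      ≡⟨ cong (r *_) (sum-symmetrise g) ⟨
    r * (Σg + Σg)                                  ≡⟨ distribˡ r Σg Σg ⟩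
    r * Σg + r * Σg                                ∎)
    where
    Σf = sum (λ j → sum (λ i → f i j))
    Σg = sum (λ j → sum (λ i → g i j))

-- Delays between jobs, and lower bounds for feasible schedules.

module ScheduleProperties {c ℓ : Level} (F : OrderedField c ℓ) (I : Scheduling.Instance F) where

  open OrderedField F
  open Scheduling F
  open OrderedFieldProperties F
  open Instance I

  duration-nonNegative : ∀ x → 0# ≤ duration I x
  duration-nonNegative (test j)            = 0≤t j
  duration-nonNegative (executeTested j)   = 0≤p j
  duration-nonNegative (executeUntested j) = 0≤u j

  share : Task n → Fin n → Carrier
  share x i = if does (job x ≟ i) then duration I x else 0#

  work : List (Task n) → Fin n → Carrier
  work []      i = 0#
  work (x ∷ l) i = share x i + work l i

  -- The recursion stops at the completion of `j`, just as `completionTime` does. On the diagonal it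
  -- measures the time spent on a job up to its own completion.
  delay : List (Task n) → Fin n → Fin n → Carrier
  delay []      i j = 0#
  delay (x ∷ l) i j = share x i + (if completes x j then 0# else delay l i j)

  mutualDelay : List (Task n) → Fin n → Fin n → Carrier
  mutualDelay l i j = delay l i j + delay l j i

  share-own : ∀ {x i} → job x ≡ i → share x i ≡ duration I x
  share-own {x} {i} x≡i rewrite dec-true (job x ≟ i) x≡i = refl

  share-other : ∀ {x i} → job x ≢ i → share x i ≡ 0#
  share-other {x} {i} x≢i rewrite dec-false (job x ≟ i) x≢i = refl

  share-nonNegative : ∀ x i → 0# ≤ share x i
  share-nonNegative x i with does (job x ≟ i)
  ... | true  = duration-nonNegative x
  ... | false = ≤-refl

  completes-other : ∀ (x : Task n) {j} → job x ≢ j → completes x j ≡ false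
  completes-other (test i)                _   = refl
  completes-other (executeTested i)   {j} i≢j = dec-false (i ≟ j) i≢j
  completes-other (executeUntested i) {j} i≢j = dec-false (i ≟ j) i≢j

  delay-nonNegative : ∀ l i j → 0# ≤ delay l i j
  delay-nonNegative []      i j = ≤-refl
  delay-nonNegative (x ∷ l) i j with completes x j
  ... | true  = +-nonNegative (share-nonNegative x i) ≤-refl
  ... | false = +-nonNegative (share-nonNegative x i) (delay-nonNegative l i j)

  delay-absent : ∀ {l i} → All (λ x → job x ≢ i) l → ∀ j → delay l i j ≡ 0#
  delay-absent [] j = refl
  delay-absent {x ∷ l} (x≢i ∷ l≢i) j with completes x j
  ... | true  = ≡-trans (cong (_+ 0#) (share-other {x} x≢i)) (+-identityˡ 0#)
  ... | false = ≡-trans (cong (_+ _) (share-other {x} x≢i)) (≡-trans (+-identityˡ _) (delay-absent l≢i j))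

  work-filter : ∀ l i → work (filter (λ x → job x ≟ i) l) i ≡ work l i
  work-filter []      i = refl
  work-filter (x ∷ l) i with job x ≟ i
  ... | yes x≡i = cong₂ _+_ (share-own {x} x≡i) (work-filter l i)
  ... | no  x≢i = ≡-trans (work-filter l i) (sym (+-identityˡ _))

  -- A discarded task belongs to neither `i` nor `j`: its share for `i` is zero, and it does not end
  -- the recursion for `j`.
  delay-filter : ∀ {q} {P : Pred (Fin n) q} (P? : Decidable P) {i j} → P i → P j →
                 ∀ l → delay (filter (P? ∘ job) l) i j ≡ delay l i j
  delay-filter P? Pi Pj [] = refl
  delay-filter {P = P} P? {i} {j} Pi Pj (x ∷ l) with P? (job x)
  ... | yes _   = cong (λ d → share x i + (if completes x j then 0# else d)) (delay-filter P? Pi Pj l)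
  ... | no ¬Px = ≡-trans (delay-filter P? Pi Pj l) (sym delay-∷)
    where
    delay-∷ : delay (x ∷ l) i j ≡ delay l i j
    delay-∷ = ≡-trans
      (cong₂ (λ s b → s + (if b then 0# else delay l i j))
        (share-other {x} λ x≡i → ¬Px (subst P (sym x≡i) Pi))
        (completes-other x λ x≡j → ¬Px (subst P (sym x≡j) Pj)))
      (+-identityˡ (delay l i j))

  sum-delay-∷ : ∀ x l j → sum (λ i → delay (x ∷ l) i j) ≡
    (if completes x j then duration I x else duration I x + sum (λ i → delay l i j))
  sum-delay-∷ x l j with completes x j
  ... | true  = ≡-trans (sum-cong-≗ (λ i → +-identityʳ (share x i))) (sum-if-≟ (job x) (duration I x))
  ... | false = ≡-trans (∑-distrib-+ (share x) (λ i → delay l i j))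
                  (cong (_+ sum (λ i → delay l i j)) (sum-if-≟ (job x) (duration I x)))

  -- Idle time is charged to no job, which is the only source of a gap between the two sides.
  sum-delay≤completionTime : ∀ σ j → sum (λ i → delay (tasks σ) i j) ≤ completionTime I σ j
  sum-delay≤completionTime []              j = ≤-reflexive (sum-replicate-zero n)
  sum-delay≤completionTime (idle d 0≤d ∷ σ) j =
    ≤-trans (sum-delay≤completionTime σ j) (x≤y+x 0≤d)
  sum-delay≤completionTime (run x ∷ σ)     j =
    ≤-trans (≤-reflexive (sum-delay-∷ x (tasks σ) j)) step
    where
    step : (if completes x j then duration I x else duration I x + sum (λ i → delay (tasks σ) i j))
           ≤ completionTime I (run x ∷ σ) j
    step with completes x j
    ... | true  = ≤-refl
    ... | false = +-monoʳ-≤ (duration I x) (sum-delay≤completionTime σ j)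

  -- The consequence of feasibility on which the lower bound rests: once `i` completes, no work on
  -- `i` remains. Unlike `Feasible`, it passes to the tail of a task list, so it supports induction.
  Tidy : Fin n → List (Task n) → Set c
  Tidy i []      = ⊤
  Tidy i (x ∷ l) = (completes x i ≡ true → work l i ≡ 0#) × Tidy i l

  tidy-filter⁻ : ∀ i l → Tidy i (filter (λ x → job x ≟ i) l) → Tidy i l
  tidy-filter⁻ i []      _ = tt
  tidy-filter⁻ i (x ∷ l) tidy with job x ≟ i
  tidy-filter⁻ i (x ∷ l) (last , tidy) | yes _ =
    (λ done → ≡-trans (sym (work-filter l i)) (last done)) , tidy-filter⁻ i l tidy
  tidy-filter⁻ i (x ∷ l) tidy | no x≢i =
    (λ done → contradiction (≡-trans (sym done) (completes-other x x≢i)) λ ()) , tidy-filter⁻ i l tidy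

  feasible⇒tidy : ∀ σ → Feasible σ → ∀ i → Tidy i (tasks σ)
  feasible⇒tidy σ feasible i with feasible i
  ... | inj₁ eq = tidy-filter⁻ i (tasks σ) (subst (Tidy i) (sym eq) ((λ _ → refl) , tt))
  ... | inj₂ eq = tidy-filter⁻ i (tasks σ) (subst (Tidy i) (sym eq) ((λ ()) , (λ _ → refl) , tt))

  -- As long as neither job is complete, both delays grow along with both works. At the first
  -- completion, tidiness says that the whole work of that job has been counted. For `i` equal to
  -- `j` both alternatives bound the work by the diagonal delay.
  work≤delay : ∀ i j l → Tidy i l → Tidy j l → work l i ≤ delay l i j ⊎ work l j ≤ delay l j i
  work≤delay i j []      _ _ = inj₁ ≤-refl
  work≤delay i j (x ∷ l) (lastᵢ , tidyᵢ) (lastⱼ , tidyⱼ)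
    with completes x i | completes x j
  ... | true  | true  = inj₁ (+-monoʳ-≤ (share x i) (≤-reflexive (lastᵢ refl)))
  ... | true  | false = inj₁ (+-monoʳ-≤ (share x i)
                          (≤-trans (≤-reflexive (lastᵢ refl)) (delay-nonNegative l i j)))
  ... | false | true  = inj₂ (+-monoʳ-≤ (share x j)
                          (≤-trans (≤-reflexive (lastⱼ refl)) (delay-nonNegative l j i)))
  ... | false | false with work≤delay i j l tidyᵢ tidyⱼ
  ...   | inj₁ wᵢ≤d = inj₁ (+-monoʳ-≤ (share x i) wᵢ≤d)
  ...   | inj₂ wⱼ≤d = inj₂ (+-monoʳ-≤ (share x j) wⱼ≤d)

  -- The two amounts of time that a feasible schedule can spend on `j`. Bounds proved against both
  -- of them hold against their minimum, the optimal `p*` of the job.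
  data Spent (j : Fin n) : Carrier → Set c where
    untested : Spent j (u j)
    tested   : Spent j (t j + p j)

  feasible⇒spent : ∀ σ → Feasible σ → ∀ i → Spent i (work (tasks σ) i)
  feasible⇒spent σ feasible i with feasible i
  ... | inj₁ eq = subst (Spent i)
    (≡-trans u≡work (≡-trans (cong (λ l → work l i) (sym eq)) (work-filter (tasks σ) i)))
    untested
    where
    u≡work : u i ≡ work (executeUntested i ∷ []) i
    u≡work rewrite share-own {executeUntested i} refl = sym (+-identityʳ (u i))
  ... | inj₂ eq = subst (Spent i)
    (≡-trans t+p≡work (≡-trans (cong (λ l → work l i) (sym eq)) (work-filter (tasks σ) i)))
    tested
    where
    t+p≡work : t i + p i ≡ work (test i ∷ executeTested i ∷ []) i
    t+p≡work rewrite share-own {test i} refl | share-own {executeTested i} refl =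
      cong (t i +_) (sym (+-identityʳ (p i)))

  -- A record rather than an equation, so that unification finds its indices.
  record MutualDelay (l : List (Task n)) (i j : Fin n) (d : Carrier) : Set c where
    constructor is
    field total≡ : mutualDelay l i j ≡ d

  mutualDelay-comm : ∀ {l i j d} → MutualDelay l i j d → MutualDelay l j i d
  mutualDelay-comm {l} {i} {j} (is eq) = is (≡-trans (+-comm (delay l j i) (delay l i j)) eq)

  -- The test completes nothing and is charged to `i`, so it only postpones `j` by `t i`.
  mutualDelay-test : ∀ {i j l d} → i ≢ j → MutualDelay l i j d → MutualDelay (test i ∷ l) i j (t i + d)
  mutualDelay-test {i} {j} {l} i≢j (is eq) = is (≡-trans
    (cong₂ (λ s s′ → s + delay l i j + (s′ + delay l j i))
      (share-own {test i} refl) (share-other {test i} i≢j))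
    (≡-trans
      (solve 3 (λ x y z → x :+ y :+ (con 0 :+ z) := x :+ (y :+ z)) refl (t i) (delay l i j) (delay l j i))
      (cong (t i +_) eq)))

  delay-completion : ∀ {i} x → job x ≡ i → completes x i ≡ true → ∀ l → delay (x ∷ l) i i ≡ duration I x
  delay-completion {i} x x≡i done l rewrite share-own {x} {i} x≡i | done = +-identityʳ (duration I x)

  -- With `i` finished, later work on `j` no longer delays `i`, and no later task of `i` exists that
  -- could delay `j`. Only `x` itself counts.
  mutualDelay-completion : ∀ {i j} x → job x ≡ i → completes x i ≡ true → i ≢ j →
    ∀ {l} → All (λ y → job y ≢ i) l → MutualDelay (x ∷ l) i j (duration I x)
  mutualDelay-completion {i} {j} x refl done i≢j {l} absent = is eq
    where
    eq : mutualDelay (x ∷ l) i j ≡ duration I x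
    eq rewrite share-own {x} {i} refl | share-other {x} i≢j | done
             | completes-other x i≢j | delay-absent absent j =
      solve 1 (λ d → d :+ con 0 :+ (con 0 :+ con 0) := d) refl (duration I x)

-- Runs of the priority queue and their restriction to a few jobs.

module SortProperties {c ℓ : Level} (F : OrderedField c ℓ)
                      (α β : OrderedField.Carrier F) (I : Scheduling.Instance F) where

  open OrderedField F
  open Scheduling F
  open OrderedFieldProperties F
  open ScheduleProperties F I
  open Instance I
  open PartialOrderReasoning poset hiding (stop)

  Runs : List (Task n) → Schedule n → Set (c ⊔ ℓ)
  Runs = Run α β I

  wt : Task n → Carrier
  wt = weight α β I

  after : Task n → List (Task n)
  after = insertedAfter α β I

  all-after : ∀ {q} {P : Pred (Fin n) q} x → P (job x) → All (P ∘ job) (after x)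
  all-after (test j)            Pj = Pj ∷ []
  all-after (executeTested j)   Pj = []
  all-after (executeUntested j) Pj = []

  -- A task inserted during the run belongs to the job of the task just extracted. In particular, a
  -- job absent from the queue never comes back.
  run-all : ∀ {q} {P : Pred (Fin n) q} {Q σ} → Runs Q σ → All (P ∘ job) Q → All (P ∘ job) (tasks σ)
  run-all stop [] = []
  run-all {P = P} (extract {x = x} Q↭ _ ρ) PQ with All-resp-↭ Q↭ PQ
  ... | Px ∷ PQ′ = Px ∷ run-all {P = P} ρ (All.++⁺ (all-after {P = P} x Px) PQ′)

  run-resp-↭ : ∀ {Q Q′ σ} → Q′ ↭ Q → Runs Q σ → Runs Q′ σ
  run-resp-↭ Q′↭Q stop rewrite ↭-empty-inv Q′↭Q = stop
  run-resp-↭ Q′↭Q (extract Q↭ least ρ)          = extract (↭-trans Q′↭Q Q↭) least ρ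

  filter-after-accept : ∀ {q} {P : Pred (Fin n) q} (P? : Decidable P) x → P (job x) →
                        filter (P? ∘ job) (after x) ≡ after x
  filter-after-accept P? (test j)            Pj = filter-accept (P? ∘ job) Pj
  filter-after-accept P? (executeTested j)   Pj = refl
  filter-after-accept P? (executeUntested j) Pj = refl

  filter-after-reject : ∀ {q} {P : Pred (Fin n) q} (P? : Decidable P) x → ¬ P (job x) →
                        filter (P? ∘ job) (after x) ≡ []
  filter-after-reject P? (test j)            ¬Pj = filter-reject (P? ∘ job) ¬Pj
  filter-after-reject P? (executeTested j)   ¬Pj = refl
  filter-after-reject P? (executeUntested j) ¬Pj = refl

  -- Weights do not depend on the rest of the queue. A kept task that is extracted is still of least
  -- weight among fewer tasks. Extracting a discarded task inserts only tasks of the same discarded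
  -- job, so the filtered queue changes at most in its order.
  run-filter : ∀ {q} {P : Pred (Fin n) q} (P? : Decidable P) {Q σ} → Runs Q σ →
    ∃[ σ′ ] Runs (filter (P? ∘ job) Q) σ′ × tasks σ′ ≡ filter (P? ∘ job) (tasks σ)
  run-filter P? stop = [] , stop , refl
  run-filter {P = P} P? (extract {Q′ = Q′} {x} Q↭ least ρ)
    with P? (job x) | run-filter P? ρ
  ... | yes Px | σ′ , ρ′ , eq = run x ∷ σ′ ,
    extract (↭-trans (filter-↭ (P? ∘ job) Q↭) (↭-reflexive (filter-accept (P? ∘ job) Px)))
            (All.filter⁺ (P? ∘ job) least)
            (subst (λ R → Runs R σ′)
              (≡-trans (filter-++ (P? ∘ job) (after x) Q′)
                (cong (_++ filter (P? ∘ job) Q′) (filter-after-accept {P = P} P? x Px)))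
              ρ′) ,
    cong (x ∷_) eq
  ... | no ¬Px | σ′ , ρ′ , eq = σ′ ,
    run-resp-↭
      (↭-trans (filter-↭ (P? ∘ job) Q↭) (↭-reflexive (filter-reject (P? ∘ job) ¬Px)))
      (subst (λ R → Runs R σ′)
        (≡-trans (filter-++ (P? ∘ job) (after x) Q′)
          (cong (_++ filter (P? ∘ job) Q′) (filter-after-reject {P = P} P? x ¬Px)))
        ρ′) ,
    eq

  job-initialTask : ∀ j → job (initialTask α β I j) ≡ j
  job-initialTask j with does (α * t j ≤? u j)
  ... | true  = refl
  ... | false = refl

  -- Applied with one or two jobs in `xs`. Their order in `xs` is free, because runs depend on the
  -- queue only up to permutation.
  sort-restrict : ∀ {xs σ} → Unique xs → SORT α β I σ →
    ∃[ σ′ ] Runs (map (initialTask α β I) xs) σ′ ×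
            (∀ {i j} → i ∈ xs → j ∈ xs → delay (tasks σ′) i j ≡ delay (tasks σ) i j)
  sort-restrict {xs} {σ} unique ρ with run-filter (λ k → _∈?_ _≟_ k xs) ρ
  ... | σ′ , ρ′ , eq = σ′ ,
    run-resp-↭
      (↭-trans (map⁺ (initialTask α β I) (↭-sym (filter-allFin-↭ unique)))
               (↭-reflexive (sym (filter-map-section (λ k → _∈?_ _≟_ k xs) job-initialTask (allFin n)))))
      ρ′ ,
    λ {i} {j} i∈xs j∈xs → ≡-trans (cong (λ l → delay l i j) eq)
      (delay-filter (λ k → _∈?_ _≟_ k xs) i∈xs j∈xs (tasks σ))

  run-completionTime : ∀ {Q σ} → Runs Q σ → ∀ j → completionTime I σ j ≡ sum (λ i → delay (tasks σ) i j)
  run-completionTime stop j = sym (sum-replicate-zero n)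
  run-completionTime (extract {x = x} {σ} _ _ ρ) j =
    ≡-trans (cong (λ d → if completes x j then duration I x else duration I x + d) (run-completionTime ρ j))
            (sym (sum-delay-∷ x (tasks σ) j))

  -- Inversion of runs from queues of one or two tasks.

  data FirstOfOne (a : Task n) : Schedule n → Set (c ⊔ ℓ) where
    first : ∀ {σ} → Runs (after a ++ []) σ → FirstOfOne a (run a ∷ σ)

  -- `extract` fixes the remaining queue only up to permutation. This view makes it a concrete list
  -- and keeps the comparison of weights; on a tie either constructor may occur.
  data FirstOfTwo (a b : Task n) : Schedule n → Set (c ⊔ ℓ) where
    first  : ∀ {σ} → wt a ≤ wt b → Runs (after a ++ [ b ]) σ → FirstOfTwo a b (run a ∷ σ)
    second : ∀ {σ} → wt b ≤ wt a → Runs (after b ++ [ a ]) σ → FirstOfTwo a b (run b ∷ σ)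

  firstOfOne : ∀ {a σ} → Runs [ a ] σ → FirstOfOne a σ
  firstOfOne (extract Q↭ _ ρ) with ↭-singleton-inv (↭-sym Q↭)
  ... | refl = first ρ

  firstOfTwo : ∀ {a b σ} → Runs (a ∷ [ b ]) σ → FirstOfTwo a b σ
  firstOfTwo {a} {b} (extract Q↭ least ρ) with ∈-resp-↭ (↭-sym Q↭) (here refl)
  ... | here refl with ↭-singleton-inv (↭-sym (drop-∷ Q↭)) | least
  ...   | refl | a≤b ∷ [] = first a≤b ρ
  firstOfTwo {a} {b} (extract Q↭ least ρ) | there (here refl)
    with ↭-singleton-inv (↭-sym (drop-∷ (trans (swap b a _↭_.refl) Q↭))) | least
  ...   | refl | b≤a ∷ [] = second b≤a ρ

  data Initial (j : Fin n) : Task n → Set ℓ where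
    tested   : α * t j ≤ u j → Initial j (test j)
    untested : u j ≤ α * t j → Initial j (executeUntested j)

  initial : ∀ j → Initial j (initialTask α β I j)
  initial j with α * t j ≤? u j
  ... | yes αt≤u = tested αt≤u
  ... | no  αt≰u with total (α * t j) (u j)
  ...   | inj₁ αt≤u = contradiction αt≤u αt≰u
  ...   | inj₂ u≤αt = untested u≤αt

  -- Numerical bounds, and the terms of the maximum that they come from.

  module Bounds (r : Carrier) (1≤α : 1# ≤ α) (1≤β : 1# ≤ β)
    (α[1+1/β]≤r : α * (1# + 1# / β) ≤ r)
    (1+1/α+1/β≤r : 1# + 1# / α + 1# / β ≤ r)
    (1+β≤r : 1# + β ≤ r)
    (2≤r : 2# ≤ r)
    (1+2/α≤r : 1# + 2# / α ≤ r) where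

    0≤α : 0# ≤ α
    0≤α = 0≤x 1≤α

    0≤β : 0# ≤ β
    0≤β = 0≤x 1≤β

    0≤1/α : 0# ≤ 1# / α
    0≤1/α = ≤-trans (0≤x⁻¹ 1≤α) (≤-reflexive (sym (*-identityˡ (α ⁻¹))))

    0≤1/β : 0# ≤ 1# / β
    0≤1/β = ≤-trans (0≤x⁻¹ 1≤β) (≤-reflexive (sym (*-identityˡ (β ⁻¹))))

    αx≤y⇒x≤1/α*y : ∀ {x y} → α * x ≤ y → x ≤ 1# / α * y
    αx≤y⇒x≤1/α*y {x} {y} αx≤y =
      ≤-trans (x*y≤z⇒y≤x⁻¹*z 1≤α αx≤y) (≤-reflexive (cong (_* y) (sym (*-identityˡ (α ⁻¹)))))

    βx≤y⇒x≤1/β*y : ∀ {x y} → β * x ≤ y → x ≤ 1# / β * y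
    βx≤y⇒x≤1/β*y {x} {y} βx≤y =
      ≤-trans (x*y≤z⇒y≤x⁻¹*z 1≤β βx≤y) (≤-reflexive (cong (_* y) (sym (*-identityˡ (β ⁻¹)))))

    α≤r : α ≤ r
    α≤r = begin
      α                    ≡⟨ *-identityʳ α ⟨
      α * 1#               ≤⟨ *-monoʳ-≤ 0≤α (x≤x+y 0≤1/β) ⟩
      α * (1# + 1# / β)    ≤⟨ α[1+1/β]≤r ⟩
      r                    ∎

    β≤r : β ≤ r
    β≤r = ≤-trans (x≤y+x 0≤1) 1+β≤r

    1+1/α≤r : 1# + 1# / α ≤ r
    1+1/α≤r = ≤-trans (x≤x+y 0≤1/β) 1+1/α+1/β≤r

    0≤r : 0# ≤ r
    0≤r = ≤-trans 0≤α α≤r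

    spent-nonNegative : ∀ {j w} → Spent j w → 0# ≤ w
    spent-nonNegative {j} untested = 0≤u j
    spent-nonNegative {j} tested   = +-nonNegative (0≤t j) (0≤p j)

    k*spent≤r*spent : ∀ {k j w} → k ≤ r → Spent j w → k * w ≤ r * w
    k*spent≤r*spent k≤r s = *-monoˡ-≤ (spent-nonNegative s) k≤r

    p≤spent : ∀ {j w} → Spent j w → p j ≤ w
    p≤spent {j} untested = p≤u j
    p≤spent {j} tested   = x≤y+x (0≤t j)

    module _ {j : Fin n} (αt≤u : α * t j ≤ u j) where

      t≤spent : ∀ {w} → Spent j w → t j ≤ w
      t≤spent untested = ≤-trans (y≤x*y 1≤α (0≤t j)) αt≤u
      t≤spent tested   = x≤x+y (0≤p j)

      k*t≤r*spent : ∀ {k} → 0# ≤ k → k ≤ r → ∀ {w} → Spent j w → k * t j ≤ r * w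
      k*t≤r*spent 0≤k k≤r s = ≤-trans (*-monoʳ-≤ 0≤k (t≤spent s)) (k*spent≤r*spent k≤r s)

      -- Against `u j`, the threshold gives a test of at most `u j` over `α`, and `p j ≤ u j`. The
      -- explicit constant leaves room for the further `1# / β` in `t+[x+p]≤r*spent`.
      t+p≤[1+1/α]*spent : ∀ {w} → Spent j w → t j + p j ≤ (1# + 1# / α) * w
      t+p≤[1+1/α]*spent untested = begin
        t j + p j                  ≤⟨ +-mono-≤ (αx≤y⇒x≤1/α*y αt≤u) (p≤u j) ⟩
        1# / α * u j + u j         ≡⟨ solve 2 (λ a x → a :* x :+ x := (con 1 :+ a) :* x) refl (1# / α) (u j) ⟩
        (1# + 1# / α) * u j        ∎
      t+p≤[1+1/α]*spent s@tested = y≤x*y (x≤x+y 0≤1/α) (spent-nonNegative s)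

      t+p≤r*spent : ∀ {w} → Spent j w → t j + p j ≤ r * w
      t+p≤r*spent s = ≤-trans (t+p≤[1+1/α]*spent s) (k*spent≤r*spent 1+1/α≤r s)

      -- The source of the terms `1# + 2# / α` (against `u j`) and `2#` (against `t j + p j`). The
      -- extra `t j` stands for the test of another job that is no longer than that of `j`.
      t+[t+p]≤r*spent : ∀ {w} → Spent j w → t j + (t j + p j) ≤ r * w
      t+[t+p]≤r*spent s@untested = begin
        t j + (t j + p j)                       ≤⟨ +-mono-≤ t≤u/α (+-mono-≤ t≤u/α (p≤u j)) ⟩
        -- The solver variable is the bare inverse of `α`, of which both quotients are multiples.
        1# / α * u j + (1# / α * u j + u j)     ≡⟨ solve 2 (λ a x → con 1 :* a :* x :+ (con 1 :* a :* x :+ x)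
                                                     := (con 1 :+ (con 1 :+ con 1) :* a) :* x) refl (α ⁻¹) (u j) ⟩
        (1# + 2# / α) * u j                     ≤⟨ k*spent≤r*spent 1+2/α≤r s ⟩
        r * u j                                 ∎
        where
        t≤u/α : t j ≤ 1# / α * u j
        t≤u/α = αx≤y⇒x≤1/α*y αt≤u
      t+[t+p]≤r*spent s@tested = begin
        t j + (t j + p j)           ≤⟨ +-monoˡ-≤ (t j + p j) (x≤x+y (0≤p j)) ⟩
        t j + p j + (t j + p j)     ≡⟨ solve 1 (λ x → x :+ x := (con 1 :+ con 1) :* x) refl (t j + p j) ⟩
        2# * (t j + p j)            ≤⟨ k*spent≤r*spent 2≤r s ⟩
        r * (t j + p j)             ∎

      -- The source of `1# + 1# / α + 1# / β`, where `x` is the test of another job that ran before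
      -- the execution of `j`.
      t+[x+p]≤r*spent : ∀ {x w} → x ≤ 1# / β * p j → Spent j w → t j + (x + p j) ≤ r * w
      t+[x+p]≤r*spent {x} {w} x≤p/β s = begin
        t j + (x + p j)                   ≡⟨ solve 3 (λ a b d → a :+ (b :+ d) := a :+ d :+ b) refl (t j) x (p j) ⟩
        t j + p j + x                     ≤⟨ +-mono-≤ (t+p≤[1+1/α]*spent s)
                                               (≤-trans x≤p/β (*-monoʳ-≤ 0≤1/β (p≤spent s))) ⟩
        (1# + 1# / α) * w + 1# / β * w    ≡⟨ solve 3 (λ a b x → a :* x :+ b :* x := (a :+ b) :* x)
                                               refl (1# + 1# / α) (1# / β) w ⟩
        (1# + 1# / α + 1# / β) * w        ≤⟨ k*spent≤r*spent 1+1/α+1/β≤r s ⟩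
        r * w                             ∎

    module _ {j : Fin n} (u≤αt : u j ≤ α * t j) where

      -- The price of not testing: below the threshold, `u j` is at most `α` times the test alone.
      u≤α*spent : ∀ {w} → Spent j w → u j ≤ α * w
      u≤α*spent untested = y≤x*y 1≤α (0≤u j)
      u≤α*spent tested   = ≤-trans u≤αt (*-monoʳ-≤ 0≤α (x≤x+y (0≤p j)))

      u≤r*spent : ∀ {w} → Spent j w → u j ≤ r * w
      u≤r*spent s = ≤-trans (u≤α*spent s) (k*spent≤r*spent α≤r s)

      -- The source of `α * (1# + 1# / β)`, where `x` is the test of another job that ran before
      -- `j`.
      x+u≤r*spent : ∀ {x w} → x ≤ 1# / β * u j → Spent j w → x + u j ≤ r * w
      x+u≤r*spent {x} {w} x≤u/β s = begin
        x + u j                      ≤⟨ +-monoˡ-≤ (u j) x≤u/β ⟩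
        1# / β * u j + u j           ≡⟨ solve 2 (λ b x → b :* x :+ x := (con 1 :+ b) :* x) refl (1# / β) (u j) ⟩
        (1# + 1# / β) * u j          ≤⟨ *-monoʳ-≤ (+-nonNegative 0≤1 0≤1/β) (u≤α*spent s) ⟩
        (1# + 1# / β) * (α * w)      ≡⟨ solve 3 (λ a b x → b :* (a :* x) := a :* b :* x) refl α (1# + 1# / β) w ⟩
        α * (1# + 1# / β) * w        ≤⟨ k*spent≤r*spent α[1+1/β]≤r s ⟩
        r * w                        ∎

    _≤r*spent-on_ : Carrier → Fin n → Set (c ⊔ ℓ)
    d ≤r*spent-on j = ∀ {w} → Spent j w → d ≤ r * w

    -- Both bounds are demanded because the competing schedule may complete either job first.
    record Bounded (l : List (Task n)) (i j : Fin n) : Set (c ⊔ ℓ) where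
      constructor bounded
      field
        {value} : Carrier
        delays  : MutualDelay l i j value
        ≤ᵢ      : value ≤r*spent-on i
        ≤ⱼ      : value ≤r*spent-on j

    bounded-sym : ∀ {l i j} → Bounded l j i → Bounded l i j
    bounded-sym (bounded m ≤ⱼ ≤ᵢ) = bounded (mutualDelay-comm m) ≤ᵢ ≤ⱼ

    module _ {i j : Fin n} (i≢j : i ≢ j) where

      mutualDelay-executeTested : ∀ {Q σ} → Runs Q σ → All (λ y → job y ≢ i) Q →
                                  MutualDelay (executeTested i ∷ tasks σ) i j (p i)
      mutualDelay-executeTested ρ absent =
        mutualDelay-completion (executeTested i) refl (dec-true (i ≟ i) refl) i≢j
          (run-all {P = _≢ i} ρ absent)

      mutualDelay-executeUntested : ∀ {Q σ} → Runs Q σ → All (λ y → job y ≢ i) Q →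
                                    MutualDelay (executeUntested i ∷ tasks σ) i j (u i)
      mutualDelay-executeUntested ρ absent =
        mutualDelay-completion (executeUntested i) refl (dec-true (i ≟ i) refl) i≢j
          (run-all {P = _≢ i} ρ absent)

    -- Case analysis of two-job queues.

    untested-first-bounded : ∀ {i j} → i ≢ j → u i ≤ α * t i → u j ≤ α * t j → u i ≤ u j → ∀ {σ} →
      Runs [ executeUntested j ] σ → Bounded (executeUntested i ∷ tasks σ) i j
    untested-first-bounded i≢j uᵢ≤αtᵢ uⱼ≤αtⱼ uᵢ≤uⱼ ρ =
      bounded (mutualDelay-executeUntested i≢j ρ (≢-sym i≢j ∷ []))
        (u≤r*spent uᵢ≤αtᵢ) (λ s → ≤-trans uᵢ≤uⱼ (u≤r*spent uⱼ≤αtⱼ s))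

    untested-untested-bounded : ∀ {i j} → i ≢ j → u i ≤ α * t i → u j ≤ α * t j → ∀ {σ} →
      Runs (executeUntested i ∷ [ executeUntested j ]) σ → Bounded (tasks σ) i j
    untested-untested-bounded i≢j uᵢ≤αtᵢ uⱼ≤αtⱼ ρ with firstOfTwo ρ
    ... | first  uᵢ≤uⱼ ρ₁ = untested-first-bounded i≢j uᵢ≤αtᵢ uⱼ≤αtⱼ uᵢ≤uⱼ ρ₁
    ... | second uⱼ≤uᵢ ρ₁ = bounded-sym (untested-first-bounded (≢-sym i≢j) uⱼ≤αtⱼ uᵢ≤αtᵢ uⱼ≤uᵢ ρ₁)

    -- If `j` runs first, the mutual delay is `u j`, at most `β * t i`. Otherwise the test of `i`
    -- takes at most `u j` over `β`, and the smaller of `p i` and `u j` runs next; the sum is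
    -- compared with `t i + p i` for `i` and with `t i + u j` for `j`.
    tested-untested-bounded : ∀ {i j} → i ≢ j → α * t i ≤ u i → u j ≤ α * t j → ∀ {σ} →
      Runs (test i ∷ [ executeUntested j ]) σ → Bounded (tasks σ) i j
    tested-untested-bounded {i} {j} i≢j αtᵢ≤uᵢ uⱼ≤αtⱼ ρ with firstOfTwo ρ
    ... | second uⱼ≤βtᵢ ρ₁ = bounded-sym
      (bounded (mutualDelay-executeUntested (≢-sym i≢j) ρ₁ (i≢j ∷ []))
        (u≤r*spent uⱼ≤αtⱼ) (λ s → ≤-trans uⱼ≤βtᵢ (k*t≤r*spent αtᵢ≤uᵢ 0≤β β≤r s)))
    ... | first βtᵢ≤uⱼ ρ₁ with firstOfTwo ρ₁
    ...   | first pᵢ≤uⱼ ρ₂ =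
      bounded (mutualDelay-test i≢j (mutualDelay-executeTested i≢j ρ₂ (≢-sym i≢j ∷ [])))
        (t+p≤r*spent αtᵢ≤uᵢ)
        (λ s → ≤-trans (+-monoʳ-≤ (t i) pᵢ≤uⱼ) (x+u≤r*spent uⱼ≤αtⱼ (βx≤y⇒x≤1/β*y βtᵢ≤uⱼ) s))
    ...   | second uⱼ≤pᵢ ρ₂ =
      bounded (mutualDelay-test i≢j (mutualDelay-comm
                (mutualDelay-executeUntested (≢-sym i≢j) ρ₂ (i≢j ∷ []))))
        (λ s → ≤-trans (+-monoʳ-≤ (t i) uⱼ≤pᵢ) (t+p≤r*spent αtᵢ≤uᵢ s))
        (x+u≤r*spent uⱼ≤αtⱼ (βx≤y⇒x≤1/β*y βtᵢ≤uⱼ))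

    -- If `i` is executed before `j` is tested, the mutual delay is `t i + p i`. Otherwise it is
    -- both tests plus the smaller processing time: for `i`, the test of `j` is at most `p i` over
    -- `β`; for `j`, the test of `i` is at most `t j`.
    test-first-bounded : ∀ {i j} → i ≢ j → α * t i ≤ u i → α * t j ≤ u j → β * t i ≤ β * t j → ∀ {σ} →
      Runs (executeTested i ∷ [ test j ]) σ → Bounded (test i ∷ tasks σ) i j
    test-first-bounded {i} {j} i≢j αtᵢ≤uᵢ αtⱼ≤uⱼ βtᵢ≤βtⱼ ρ = bound (firstOfTwo ρ)
      where
      tᵢ≤tⱼ : t i ≤ t j
      tᵢ≤tⱼ = x*-cancel-≤ 1≤β βtᵢ≤βtⱼ

      -- Here `q` is the processing time of whichever job is executed first, so it lies below both
      -- `p i` and `p j`.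
      both-tested : ∀ {l q} → MutualDelay l j i q → β * t j ≤ p i → q ≤ p i → q ≤ p j →
                    Bounded (test i ∷ test j ∷ l) i j
      both-tested m βtⱼ≤pᵢ q≤pᵢ q≤pⱼ =
        bounded (mutualDelay-test i≢j (mutualDelay-comm (mutualDelay-test (≢-sym i≢j) m)))
          (λ s → ≤-trans (+-monoʳ-≤ (t i) (+-monoʳ-≤ (t j) q≤pᵢ))
                   (t+[x+p]≤r*spent αtᵢ≤uᵢ (βx≤y⇒x≤1/β*y βtⱼ≤pᵢ) s))
          (λ s → ≤-trans (+-mono-≤ tᵢ≤tⱼ (+-monoʳ-≤ (t j) q≤pⱼ)) (t+[t+p]≤r*spent αtⱼ≤uⱼ s))

      bound : ∀ {σ} → FirstOfTwo (executeTested i) (test j) σ → Bounded (test i ∷ tasks σ) i j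
      bound (first pᵢ≤βtⱼ ρ₁) =
        bounded (mutualDelay-test i≢j (mutualDelay-executeTested i≢j ρ₁ (≢-sym i≢j ∷ [])))
          (t+p≤r*spent αtᵢ≤uᵢ)
          -- The source of the term `1# + β`.
          (λ {w} s → begin
            t i + p i           ≤⟨ +-mono-≤ tᵢ≤tⱼ pᵢ≤βtⱼ ⟩
            t j + β * t j       ≡⟨ solve 2 (λ b x → x :+ b :* x := (con 1 :+ b) :* x) refl β (t j) ⟩
            (1# + β) * t j      ≤⟨ k*t≤r*spent αtⱼ≤uⱼ (+-nonNegative 0≤1 0≤β) 1+β≤r s ⟩
            r * w               ∎)
      bound (second βtⱼ≤pᵢ ρ₁) with firstOfTwo ρ₁
      ... | first pⱼ≤pᵢ ρ₂ =
        both-tested (mutualDelay-executeTested (≢-sym i≢j) ρ₂ (i≢j ∷ [])) βtⱼ≤pᵢ pⱼ≤pᵢ ≤-refl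
      ... | second pᵢ≤pⱼ ρ₂ =
        both-tested (mutualDelay-comm (mutualDelay-executeTested i≢j ρ₂ (≢-sym i≢j ∷ [])))
          βtⱼ≤pᵢ ≤-refl pᵢ≤pⱼ

    pair-bounded : ∀ {i j a b σ} → i ≢ j → Initial i a → Initial j b → Runs (a ∷ [ b ]) σ →
                   Bounded (tasks σ) i j
    pair-bounded i≢j (untested uᵢ≤αtᵢ) (untested uⱼ≤αtⱼ) ρ = untested-untested-bounded i≢j uᵢ≤αtᵢ uⱼ≤αtⱼ ρ
    pair-bounded i≢j (tested αtᵢ≤uᵢ) (untested uⱼ≤αtⱼ) ρ = tested-untested-bounded i≢j αtᵢ≤uᵢ uⱼ≤αtⱼ ρ
    pair-bounded i≢j (untested uᵢ≤αtᵢ) (tested αtⱼ≤uⱼ) ρ =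
      bounded-sym (tested-untested-bounded (≢-sym i≢j) αtⱼ≤uⱼ uᵢ≤αtᵢ (run-resp-↭ (swap _ _ _↭_.refl) ρ))
    pair-bounded i≢j (tested αtᵢ≤uᵢ) (tested αtⱼ≤uⱼ) ρ with firstOfTwo ρ
    ... | first  βtᵢ≤βtⱼ ρ₁ = test-first-bounded i≢j αtᵢ≤uᵢ αtⱼ≤uⱼ βtᵢ≤βtⱼ ρ₁
    ... | second βtⱼ≤βtᵢ ρ₁ = bounded-sym (test-first-bounded (≢-sym i≢j) αtⱼ≤uⱼ αtᵢ≤uᵢ βtⱼ≤βtᵢ ρ₁)

    single-bounded : ∀ {i a σ} → Initial i a → Runs [ a ] σ → delay (tasks σ) i i ≤r*spent-on i
    single-bounded {i} (untested u≤αt) ρ s with firstOfOne ρ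
    ... | first {σ₁} _ = ≤-trans
      (≤-reflexive (delay-completion (executeUntested i) refl (dec-true (i ≟ i) refl) (tasks σ₁)))
      (u≤r*spent u≤αt s)
    single-bounded {i} (tested αt≤u) ρ s with firstOfOne ρ
    ... | first ρ₁ with firstOfOne ρ₁
    ...   | first {σ₂} _ = ≤-trans
      (≤-reflexive (cong₂ _+_ (share-own {test i} refl)
        (delay-completion (executeTested i) refl (dec-true (i ≟ i) refl) (tasks σ₂))))
      (t+p≤r*spent αt≤u s)

    -- From one and two jobs to the total cost.

    sort-delay≤ : ∀ {σ} → SORT α β I σ → ∀ i → delay (tasks σ) i i ≤r*spent-on i
    sort-delay≤ sort i {w} s with sort-restrict ([] ∷ []) sort
    ... | σ′ , ρ , delay≡ =
      subst (_≤ r * w) (delay≡ (here refl) (here refl)) (single-bounded (initial i) ρ s)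

    sort-mutualDelay≤ : ∀ {σ} → SORT α β I σ → ∀ {i j} → i ≢ j →
      (mutualDelay (tasks σ) i j ≤r*spent-on i) × (mutualDelay (tasks σ) i j ≤r*spent-on j)
    sort-mutualDelay≤ sort {i} {j} i≢j with sort-restrict ((i≢j ∷ []) ∷ [] ∷ []) sort
    ... | σ′ , ρ , delay≡ with pair-bounded i≢j (initial i) (initial j) ρ
    ...   | bounded (is refl) ≤ᵢ ≤ⱼ = subst (λ d → (d ≤r*spent-on i) × (d ≤r*spent-on j))
      (cong₂ _+_ (delay≡ (here refl) (there (here refl))) (delay≡ (there (here refl)) (here refl)))
      (≤ᵢ , ≤ⱼ)

    -- The job that completes first in `σ*` contributes its whole work to the mutual delay there,
    -- and that work is one of the two amounts against which the delay in `σ` is bounded.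
    mutualDelay≤r*feasible : ∀ {σ} → SORT α β I σ → ∀ σ* → Feasible σ* → ∀ i j →
      mutualDelay (tasks σ) i j ≤ r * mutualDelay (tasks σ*) i j
    mutualDelay≤r*feasible {σ} sort σ* feasible i j
      with i ≟ j | work≤delay i j (tasks σ*) (feasible⇒tidy σ* feasible i) (feasible⇒tidy σ* feasible j)
    ... | no i≢j | inj₁ wᵢ≤d = begin
      mutualDelay (tasks σ) i j         ≤⟨ proj₁ (sort-mutualDelay≤ sort i≢j) (feasible⇒spent σ* feasible i) ⟩
      r * work (tasks σ*) i             ≤⟨ *-monoʳ-≤ 0≤r (≤-trans wᵢ≤d (x≤x+y (delay-nonNegative (tasks σ*) j i))) ⟩
      r * mutualDelay (tasks σ*) i j    ∎
    ... | no i≢j | inj₂ wⱼ≤d = begin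
      mutualDelay (tasks σ) i j         ≤⟨ proj₂ (sort-mutualDelay≤ sort i≢j) (feasible⇒spent σ* feasible j) ⟩
      r * work (tasks σ*) j             ≤⟨ *-monoʳ-≤ 0≤r (≤-trans wⱼ≤d (x≤y+x (delay-nonNegative (tasks σ*) i j))) ⟩
      r * mutualDelay (tasks σ*) i j    ∎
    -- On the diagonal the mutual delay is twice the delay of a job by itself, so the one-job bound
    -- applies to each half.
    ... | yes refl | w≤d = begin
      mutualDelay (tasks σ) i i                               ≤⟨ +-mono-≤ delay≤ delay≤ ⟩
      r * delay (tasks σ*) i i + r * delay (tasks σ*) i i     ≡⟨ distribˡ r (delay (tasks σ*) i i) (delay (tasks σ*) i i) ⟨
      r * mutualDelay (tasks σ*) i i                          ∎
      where
      delay≤ : delay (tasks σ) i i ≤ r * delay (tasks σ*) i i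
      delay≤ = ≤-trans (sort-delay≤ sort i (feasible⇒spent σ* feasible i)) (*-monoʳ-≤ 0≤r (reduce w≤d))

    sort-cost≤ : ∀ {σ} → SORT α β I σ → ∀ σ* → Feasible σ* → cost I σ ≤ r * cost I σ*
    sort-cost≤ {σ} sort σ* feasible = begin
      cost I σ                                            ≡⟨ sum-cong-≗ (run-completionTime sort) ⟩
      sum (λ j → sum (λ i → delay (tasks σ) i j))         ≤⟨ sum-pairwise-≤ r (delay (tasks σ)) (delay (tasks σ*))
                                                               (mutualDelay≤r*feasible sort σ* feasible) ⟩
      r * sum (λ j → sum (λ i → delay (tasks σ*) i j))    ≤⟨ *-monoʳ-≤ 0≤r (sum-mono-≤ (sum-delay≤completionTime σ*)) ⟩
      r * cost I σ*                                       ∎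

theorem3 : ∀ {c ℓ : Level} (F : OrderedField c ℓ) →
    let open OrderedField F
        open Scheduling F
    in ∀ (α β : Carrier) → 1# ≤ α → 1# ≤ β →
       CompetitiveRatioAtMost (SORT α β)
         (max (α * (1# + 1# / β))
         (max (1# + 1# / α + 1# / β)
         (max (1# + β)
         (max 2# (1# + 2# / α)))))
-- A least ratio lies below every valid ratio, so the second component follows from the first.
theorem3 {c} {ℓ} F α β 1≤α 1≤β = competitive , λ _ least → proj₂ least _ competitive
  where
  open OrderedField F
  open OrderedFieldProperties F
  open Scheduling F

  b₁ b₂ b₃ b₄ b₅ : Carrier
  b₁ = α * (1# + 1# / β)
  b₂ = 1# + 1# / α + 1# / β
  b₃ = 1# + β
  b₄ = 2#
  b₅ = 1# + 2# / α

  skip : ∀ {x} y {z} → x ≤ z → x ≤ max y z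
  skip y {z} x≤z = ≤-trans x≤z (x≤y⊔x y z)

  competitive : Competitive (SORT α β) (max b₁ (max b₂ (max b₃ (max b₄ b₅))))
  competitive I σ sort σ* (feasible , _) = sort-cost≤ sort σ* feasible
    where
    open SortProperties F α β I
    open Bounds (max b₁ (max b₂ (max b₃ (max b₄ b₅)))) 1≤α 1≤β
      (x≤x⊔y b₁ _)
      (skip b₁ (x≤x⊔y b₂ _))
      (skip b₁ (skip b₂ (x≤x⊔y b₃ _)))
      (skip b₁ (skip b₂ (skip b₃ (x≤x⊔y b₄ b₅))))
      (skip b₁ (skip b₂ (skip b₃ (x≤y⊔x b₄ b₅))))
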